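{- Let $\Theta$ be a causal theory over $\mathfrak L$. Every sequent derivable in the sequent calculus $\mathbf{S}_\Theta$ has a derivation in $\mathbf{S}_\Theta$ that does not use the multicut rule.
   Context: $\mathfrak L$ is a classical propositional language (atoms, $\neg,\wedge,\vee,\to,\top,\perp$). A causal rule is $\phi\triangleright\psi$ with $\phi,\psi\in\mathfrak L$; a causal theory $\Theta$ is a set of causal rules. $\mathcal L_\Box$ is generated by $\mathfrak L$ and a unary operator $\Box$. The sequent calculus $\mathbf S_\Theta$ derives sequents $\Gamma\vdash_\Box\Delta$ with $\Gamma,\Delta$ collections of $\mathcal L_\Box$-formulas; derivations are well-founded, possibly infinitely branching trees. Its rules: axiom $p\vdash_\Box p$; $\perp\vdash_\Box$; $\vdash_\Box\top$; left and right weakening and contraction; the classical two-sided rules: $\neg$L (from $\Gamma\vdash_\Box p,\Delta$ infer $\Gamma,\neg p\vdash_\Box\Delta$), $\neg$R (from $\Gamma,p\vdash_\Box\Delta$ infer $\Gamma\vdash_\Box\neg p,\Delta$), $\wedge$L (from $\Gamma,p,q\vdash_\Box\Delta$ infer $\Gamma,p\wedge q\vdash_\Box\Delta$), $\wedge$R (from $\Gamma\vdash_\Box p,\Delta$ and $\Gamma\vdash_\Box q,\Delta$ infer $\Gamma\vdash_\Box p\wedge q,\Delta$), $\vee$L (from $\Gamma,p\vdash_\Box\Delta$ and $\Gamma,q\vdash_\Box\Delta$ infer $\Gamma,p\vee q\vdash_\Box\Delta$), $\vee$R (from $\Gamma\vdash_\Box p,q,\Delta$ infer $\Gamma\vdash_\Box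 p\vee q,\Delta$), $\to$L (from $\Gamma\vdash_\Box p,\Delta$ and $\Gamma,q\vdash_\Box\Delta$ infer $\Gamma,p\to q\vdash_\Box\Delta$), $\to$R (from $\Gamma,p\vdash_\Box q,\Delta$ infer $\Gamma\vdash_\Box p\to q,\Delta$); $\Box$R: if $\phi_1\triangleright\psi_1,\dots,\phi_k\triangleright\psi_k\in\Theta$ and $\psi_1,\dots,\psi_k\vdash_\Box p$ is derivable, then from $\Gamma\vdash_\Box\phi_1\wedge\dots\wedge\phi_k,\Delta$ infer $\Gamma\vdash_\Box\Box p,\Delta$ (empty conjunction $=\top$); $\Box$L: letting $\{S_j\}_{j\in J}$ be the family of all finite sets $S_j\subseteq\Theta$ such that $\{\psi:\phi\triangleright\psi\in S_j\}\vdash_\Box p$ is derivable ($J$ may be infinite), from the premises $\Gamma,\{\phi:\phi\triangleright\psi\in S_j\}\vdash_\Box\Delta$ for all $j\in J$ infer $\Gamma,\Box p\vdash_\Box\Delta$; multicut: from $\Gamma\vdash_\Box p^m,\Delta$ and $\Gamma',p^n\vdash_\Box\Delta'$ ($m,n>0$, $p^n$ meaning $n$ occurrences of $p$) infer $\Gamma,\Gamma'\vdash_\Box\Delta,\Delta'$.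
   Formalization: The □-rules' side condition refers circularly (in □L negatively) to derivability in S_Θ itself; here "ψ's ⊢ p is derivable" for □p means derivability, multicut included, where cut formulas and principal □-formulas have modal depth at most that of p. -}

module Defs where

open import Data.Empty using (⊥)
open import Data.List using (List; []; _∷_; [_]; _++_; map; replicate)
open import Data.List.Relation.Binary.Permutation.Propositional using (_↭_)
open import Data.List.Relation.Unary.All using (All)
open import Data.Nat using (ℕ; suc; _⊔_; _≤_; _<_)
open import Data.Nat.Induction using (<-wellFounded)
open import Data.Product using (_×_; _,_; Σ-syntax)
open import Data.Unit using (⊤)
open import Induction.WellFounded using (Acc; acc)
open import Level using (0ℓ)
open import Relation.Unary using (Pred; U)

data Language : Set where
  classical modal : Language

infix  9 ¬ᶠ_ □_
infixr 8 _∧ᶠ_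
infixr 7 _∨ᶠ_
infixr 6 _→ᶠ_

-- Formula Atom classical is 𝔏, Formula Atom modal is 𝓛_□.
data Formula (Atom : Set) : Language → Set where
  atom  : ∀ {l} → Atom → Formula Atom l
  ⊤ᶠ ⊥ᶠ : ∀ {l} → Formula Atom l
  ¬ᶠ_   : ∀ {l} → Formula Atom l → Formula Atom l
  _∧ᶠ_ _∨ᶠ_ _→ᶠ_ : ∀ {l} → Formula Atom l → Formula Atom l → Formula Atom l
  □_    : Formula Atom modal → Formula Atom modal

infix 5 _▷_

record CausalRule (Atom : Set) : Set where
  constructor _▷_
  field
    cause  : Formula Atom classical
    effect : Formula Atom classical

open CausalRule public

CausalTheory : Set → Set₁
CausalTheory Atom = Pred (CausalRule Atom) 0ℓ

module _ {Atom : Set} where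

  embed : Formula Atom classical → Formula Atom modal
  embed (atom a) = atom a
  embed ⊤ᶠ       = ⊤ᶠ
  embed ⊥ᶠ       = ⊥ᶠ
  embed (¬ᶠ p)   = ¬ᶠ embed p
  embed (p ∧ᶠ q) = embed p ∧ᶠ embed q
  embed (p ∨ᶠ q) = embed p ∨ᶠ embed q
  embed (p →ᶠ q) = embed p →ᶠ embed q

  depth : Formula Atom modal → ℕ
  depth (atom a) = 0
  depth ⊤ᶠ       = 0
  depth ⊥ᶠ       = 0
  depth (¬ᶠ p)   = depth p
  depth (p ∧ᶠ q) = depth p ⊔ depth q
  depth (p ∨ᶠ q) = depth p ⊔ depth q
  depth (p →ᶠ q) = depth p ⊔ depth q
  depth (□ p)    = suc (depth p)

  ⋀ : List (Formula Atom modal) → Formula Atom modal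
  ⋀ []           = ⊤ᶠ
  ⋀ (p ∷ [])     = p
  ⋀ (p ∷ q ∷ ps) = p ∧ᶠ ⋀ (q ∷ ps)

  causes effects : List (CausalRule Atom) → List (Formula Atom modal)
  causes  S = map (λ r → embed (cause r)) S
  effects S = map (λ r → embed (effect r)) S

  -- The rules of S_Θ, over two parameters.  Side S p is the side condition of
  -- the □-rules, "the effects of S entail p"; L is the sublanguage in which the
  -- derivation takes place.  L constrains only cut formulas and principal
  -- □-formulas: apart from multicut, premises contain only subformulas of the
  -- conclusion and 𝔏-formulas, so a derivation of a sequent in L stays in L.
  --
  -- Sequents consist of finite multisets, given as lists with `exchange`.
  -- Finite subsets of Θ are given as lists of members of Θ.
  data Derivation (Θ : CausalTheory Atom)
                  (L : Pred (Formula Atom modal) 0ℓ)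
                  (Side : List (CausalRule Atom) → Formula Atom modal → Set)
                  : (Γ Δ : List (Formula Atom modal)) → Set where

    exchange : ∀ {Γ Γ′ Δ Δ′} → Γ ↭ Γ′ → Δ ↭ Δ′ →
               Derivation Θ L Side Γ Δ →
               Derivation Θ L Side Γ′ Δ′

    axiom : ∀ {p} → Derivation Θ L Side [ p ] [ p ]
    ⊥L    : Derivation Θ L Side [ ⊥ᶠ ] []
    ⊤R    : Derivation Θ L Side [] [ ⊤ᶠ ]

    weakenL   : ∀ {Γ Δ p} →
                Derivation Θ L Side Γ Δ →
                Derivation Θ L Side (p ∷ Γ) Δ
    weakenR   : ∀ {Γ Δ p} →
                Derivation Θ L Side Γ Δ →
                Derivation Θ L Side Γ (p ∷ Δ)
    contractL : ∀ {Γ Δ p} →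
                Derivation Θ L Side (p ∷ p ∷ Γ) Δ →
                Derivation Θ L Side (p ∷ Γ) Δ
    contractR : ∀ {Γ Δ p} →
                Derivation Θ L Side Γ (p ∷ p ∷ Δ) →
                Derivation Θ L Side Γ (p ∷ Δ)

    ¬L : ∀ {Γ Δ p} →
         Derivation Θ L Side Γ (p ∷ Δ) →
         Derivation Θ L Side (¬ᶠ p ∷ Γ) Δ
    ¬R : ∀ {Γ Δ p} →
         Derivation Θ L Side (p ∷ Γ) Δ →
         Derivation Θ L Side Γ (¬ᶠ p ∷ Δ)

    ∧L : ∀ {Γ Δ p q} →
         Derivation Θ L Side (p ∷ q ∷ Γ) Δ →
         Derivation Θ L Side (p ∧ᶠ q ∷ Γ) Δ
    ∧R : ∀ {Γ Δ p q} →
         Derivation Θ L Side Γ (p ∷ Δ) →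
         Derivation Θ L Side Γ (q ∷ Δ) →
         Derivation Θ L Side Γ (p ∧ᶠ q ∷ Δ)

    ∨L : ∀ {Γ Δ p q} →
         Derivation Θ L Side (p ∷ Γ) Δ →
         Derivation Θ L Side (q ∷ Γ) Δ →
         Derivation Θ L Side (p ∨ᶠ q ∷ Γ) Δ
    ∨R : ∀ {Γ Δ p q} →
         Derivation Θ L Side Γ (p ∷ q ∷ Δ) →
         Derivation Θ L Side Γ (p ∨ᶠ q ∷ Δ)

    →L : ∀ {Γ Δ p q} →
         Derivation Θ L Side Γ (p ∷ Δ) →
         Derivation Θ L Side (q ∷ Γ) Δ →
         Derivation Θ L Side (p →ᶠ q ∷ Γ) Δ
    →R : ∀ {Γ Δ p q} →
         Derivation Θ L Side (p ∷ Γ) (q ∷ Δ) →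
         Derivation Θ L Side Γ (p →ᶠ q ∷ Δ)

    □R : ∀ {Γ Δ p} → L (□ p) →
         (S : List (CausalRule Atom)) → All Θ S → Side S p →
         Derivation Θ L Side Γ (⋀ (causes S) ∷ Δ) →
         Derivation Θ L Side Γ (□ p ∷ Δ)
    □L : ∀ {Γ Δ p} → L (□ p) →
         ((S : List (CausalRule Atom)) → All Θ S → Side S p →
           Derivation Θ L Side (causes S ++ Γ) Δ) →
         Derivation Θ L Side (□ p ∷ Γ) Δ

    multicut : ∀ {Γ Γ′ Δ Δ′ p} → L p → (m n : ℕ) →
               Derivation Θ L Side Γ (replicate (suc m) p ++ Δ) →
               Derivation Θ L Side (replicate (suc n) p ++ Γ′) Δ′ →
               Derivation Θ L Side (Γ ++ Γ′) (Δ ++ Δ′)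

  module _ {Θ : CausalTheory Atom}
           {L : Pred (Formula Atom modal) 0ℓ}
           {Side : List (CausalRule Atom) → Formula Atom modal → Set}
           (SideCutFree : ∀ {S p} → Side S p → Set) where

    -- Multicut is excluded also from the derivations that witness the side
    -- conditions of □R.
    NoMulticut : ∀ {Γ Δ} → Derivation Θ L Side Γ Δ → Set
    NoMulticut (exchange _ _ d)     = NoMulticut d
    NoMulticut axiom                = ⊤
    NoMulticut ⊥L                   = ⊤
    NoMulticut ⊤R                   = ⊤
    NoMulticut (weakenL d)          = NoMulticut d
    NoMulticut (weakenR d)          = NoMulticut d
    NoMulticut (contractL d)        = NoMulticut d
    NoMulticut (contractR d)        = NoMulticut d
    NoMulticut (¬L d)               = NoMulticut d
    NoMulticut (¬R d)               = NoMulticut d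
    NoMulticut (∧L d)               = NoMulticut d
    NoMulticut (∧R d e)             = NoMulticut d × NoMulticut e
    NoMulticut (∨L d e)             = NoMulticut d × NoMulticut e
    NoMulticut (∨R d)               = NoMulticut d
    NoMulticut (→L d e)             = NoMulticut d × NoMulticut e
    NoMulticut (→R d)               = NoMulticut d
    NoMulticut (□R _ _ _ side d)    = SideCutFree side × NoMulticut d
    NoMulticut (□L _ ds)            = ∀ S S⊆Θ side → NoMulticut (ds S S⊆Θ side)
    NoMulticut (multicut _ _ _ _ _) = ⊥

  -- The side conditions refer to derivability in S_Θ itself, in □L negatively,
  -- so the calculus is defined by recursion on modal depth: the condition
  -- "effects S ⊢ p" attached to □ p means derivability over the sublanguage of
  -- formulas of modal depth at most depth p, which contains that sequent.
  Bounded : CausalTheory Atom → ∀ n → Acc _<_ n →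
            (Γ Δ : List (Formula Atom modal)) → Set
  Bounded Θ n (acc rs) =
    Derivation Θ (λ p → depth p ≤ n)
      (λ S p → Σ[ lt ∈ depth p < n ] Bounded Θ (depth p) (rs lt) (effects S) [ p ])

  BoundedCutFree : ∀ {Θ} n (a : Acc _<_ n) {Γ Δ} → Bounded Θ n a Γ Δ → Set
  BoundedCutFree n (acc rs) =
    NoMulticut (λ {S} {p} (lt , d) → BoundedCutFree (depth p) (rs lt) d)

  -- S[ Θ ] Γ Δ is the type of derivations of Γ ⊢_□ Δ in S_Θ.
  S[_] : CausalTheory Atom → (Γ Δ : List (Formula Atom modal)) → Set
  S[ Θ ] =
    Derivation Θ U
      (λ S p → Bounded Θ (depth p) (<-wellFounded (depth p)) (effects S) [ p ])

  CutFree : ∀ {Θ Γ Δ} → S[ Θ ] Γ Δ → Set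
  CutFree =
    NoMulticut (λ {S} {p} d → BoundedCutFree (depth p) (<-wellFounded (depth p)) d)

{-# OPTIONS --safe #-}
-- A cut-free sequent is rewritten as one list of signed formulas, in a calculus
-- whose rules keep their principal formula and locate it by membership.  There
-- exchange, weakening and contraction are all monotonicity under inclusion.  Cut is
-- then admissible by induction on the cut formula and, inside, on the two
-- derivations; the inclusions are carried as arguments, so that the recursion is
-- structural even though □L branches infinitely.  A principal cut on □ p against
-- the set S chosen by □R selects the premise of □L for the same S, leaving cuts
-- on the causes of S.  These are box-free, so their cuts are eliminated first, and the
-- induction on formulas is not disturbed by causes that are not subformulas of □ p.
module Submission where

open import Data.Bool using (Bool; true; false; if_then_else_)
open import Data.Empty using (⊥)
open import Data.List using (List; []; _∷_; [_]; _++_; map; replicate)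
open import Data.List.Membership.Propositional using (_∈_)
open import Data.List.Membership.Propositional.Properties using (∈-++⁺ˡ; ∈-++⁺ʳ; ∈-++⁻; ∈-map⁺)
open import Data.List.Properties using (++-identityʳ)
open import Data.List.Relation.Binary.Permutation.Propositional using (_↭_; ↭-refl; ↭-sym; prep; swap; ↭-trans)
open import Data.List.Relation.Binary.Permutation.Propositional.Properties using (∈-resp-↭; ++-comm)
open import Data.List.Relation.Binary.Subset.Propositional using (_⊆_)
open import Data.List.Relation.Binary.Subset.Propositional.Properties using (++⁺ʳ; ∷⁺ʳ)
open import Data.List.Relation.Unary.All using (All; []; _∷_; universal)
open import Data.List.Relation.Unary.All.Properties using (map⁺)
open import Data.List.Relation.Unary.Any using (here; there)
open import Data.Nat using (zero; suc; _<_)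
open import Data.Nat.Induction using (<-wellFounded)
open import Data.Product using (_×_; _,_; proj₁; proj₂; Σ; Σ-syntax)
open import Data.Sum using (inj₁; inj₂)
open import Data.Unit using (⊤; tt)
open import Function using (_∘_; id)
open import Induction.WellFounded using (Acc; acc)
open import Level using (0ℓ)
open import Relation.Binary.PropositionalEquality using (_≡_; refl; cong; trans; subst₂)
open import Relation.Unary using (Pred)
open import Defs

-- Signed sequents and their two sides

infix 5.5 _⁻ _⁺

-- p ⁻ is an occurrence of p in the antecedent, p ⁺ one in the succedent.
data Signed (Atom : Set) : Set where
  _⁻ _⁺ : Formula Atom modal → Signed Atom

module _ {Atom : Set} where

  antecedent succedent : List (Signed Atom) → List (Formula Atom modal)
  antecedent []        = []
  antecedent (p ⁻ ∷ X) = p ∷ antecedent X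
  antecedent (p ⁺ ∷ X) = antecedent X
  succedent []         = []
  succedent (p ⁻ ∷ X)  = succedent X
  succedent (p ⁺ ∷ X)  = p ∷ succedent X

  antecedent-map⁻ : ∀ Γ X → antecedent (map _⁻ Γ ++ X) ≡ Γ ++ antecedent X
  antecedent-map⁻ []      X = refl
  antecedent-map⁻ (p ∷ Γ) X = cong (p ∷_) (antecedent-map⁻ Γ X)

  succedent-map⁻ : ∀ Γ X → succedent (map _⁻ Γ ++ X) ≡ succedent X
  succedent-map⁻ []      X = refl
  succedent-map⁻ (p ∷ Γ) X = succedent-map⁻ Γ X

  antecedent-map⁺ : ∀ Δ → antecedent (map _⁺ Δ) ≡ []
  antecedent-map⁺ []      = refl
  antecedent-map⁺ (p ∷ Δ) = antecedent-map⁺ Δ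

  succedent-map⁺ : ∀ Δ → succedent (map _⁺ Δ) ≡ Δ
  succedent-map⁺ []      = refl
  succedent-map⁺ (p ∷ Δ) = cong (p ∷_) (succedent-map⁺ Δ)

  antecedent⁺ : ∀ {p X} → p ⁻ ∈ X → p ∈ antecedent X
  antecedent⁺               (here refl) = here refl
  antecedent⁺ {X = q ⁻ ∷ X} (there m)   = there (antecedent⁺ m)
  antecedent⁺ {X = q ⁺ ∷ X} (there m)   = antecedent⁺ m

  succedent⁺ : ∀ {p X} → p ⁺ ∈ X → p ∈ succedent X
  succedent⁺               (here refl) = here refl
  succedent⁺ {X = q ⁻ ∷ X} (there m)   = succedent⁺ m
  succedent⁺ {X = q ⁺ ∷ X} (there m)   = there (succedent⁺ m)

-- Membership and inclusion of lists

module _ {A : Set} where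

  ∈⇒↭ : ∀ {x : A} {xs} → x ∈ xs → Σ[ ys ∈ List A ] x ∷ ys ↭ xs
  ∈⇒↭ {xs = _ ∷ xs} (here refl) = xs , ↭-refl
  ∈⇒↭ {xs = y ∷ _}  (there m) with ys , ρ ← ∈⇒↭ m =
    y ∷ ys , ↭-trans (swap _ _ ↭-refl) (prep y ρ)

  ∷-absorb : ∀ {x : A} {xs} → x ∈ xs → x ∷ xs ⊆ xs
  ∷-absorb m (here refl) = m
  ∷-absorb m (there i)   = i

  -- Carries an inclusion up to the cut formula `x` from the conclusion of a rule to a premise that
  -- adds `zs`.
  ++-lift-⊆-∷ : ∀ {xs ys : List A} {x} zs → xs ⊆ x ∷ ys → zs ++ xs ⊆ x ∷ zs ++ ys
  ++-lift-⊆-∷ zs f m with ∈-++⁻ zs m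
  ... | inj₁ i = there (∈-++⁺ˡ i)
  ... | inj₂ i with f i
  ...   | here e  = here e
  ...   | there j = there (∈-++⁺ʳ zs j)

  replicate-++⁻ : ∀ {x y : A} {ys} n → y ∈ replicate n x ++ ys → y ∈ x ∷ ys
  replicate-++⁻ zero    m           = there m
  replicate-++⁻ (suc n) (here refl) = here refl
  replicate-++⁻ (suc n) (there m)   = replicate-++⁻ n m

module _ {Atom : Set} {Θ : CausalTheory Atom}
         {L : Pred (Formula Atom modal) 0ℓ}
         {Side : List (CausalRule Atom) → Formula Atom modal → Set}
         (SideCutFree : ∀ {S p} → Side S p → Set) where

  -- The signed calculus

  data Rule : Signed Atom → Set where
    ⊥L : Rule (⊥ᶠ ⁻)
    ⊤R : Rule (⊤ᶠ ⁺)
    ¬L : ∀ {p} → Rule (¬ᶠ p ⁻)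
    ¬R : ∀ {p} → Rule (¬ᶠ p ⁺)
    ∧L : ∀ {p q} → Rule (p ∧ᶠ q ⁻)
    ∧R : ∀ {p q} → Rule (p ∧ᶠ q ⁺)
    ∨L : ∀ {p q} → Rule (p ∨ᶠ q ⁻)
    ∨R : ∀ {p q} → Rule (p ∨ᶠ q ⁺)
    →L : ∀ {p q} → Rule (p →ᶠ q ⁻)
    →R : ∀ {p q} → Rule (p →ᶠ q ⁺)
    □L : ∀ {p} → L (□ p) → Rule (□ p ⁻)
    -- Storing `SideCutFree s` keeps the calculus cut-free in its side conditions as well.
    □R : ∀ {p} → L (□ p) → ∀ S → All Θ S → (s : Side S p) → SideCutFree s → Rule (□ p ⁺)

  Premise : ∀ {x} → Rule x → Set
  Premise ⊥L = ⊥
  Premise ⊤R = ⊥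
  Premise ∧R = Bool
  Premise ∨L = Bool
  Premise →L = Bool
  Premise (□L {p} _) = Σ[ S ∈ List (CausalRule Atom) ] All Θ S × Side S p
  Premise _ = ⊤

  added : ∀ {x} (r : Rule x) → Premise r → List (Signed Atom)
  added (¬L {p})     _ = [ p ⁺ ]
  added (¬R {p})     _ = [ p ⁻ ]
  added (∧L {p} {q}) _ = p ⁻ ∷ q ⁻ ∷ []
  added (∧R {p} {q}) b = [ if b then p ⁺ else q ⁺ ]
  added (∨L {p} {q}) b = [ if b then p ⁻ else q ⁻ ]
  added (∨R {p} {q}) _ = p ⁺ ∷ q ⁺ ∷ []
  added (→L {p} {q}) b = [ if b then p ⁺ else q ⁻ ]
  added (→R {p} {q}) _ = p ⁻ ∷ q ⁺ ∷ []
  added (□L _) (S , _) = map _⁻ (causes S)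
  added (□R _ S _ _ _) _ = [ ⋀ (causes S) ⁺ ]

  infix 3 ⊢_

  data ⊢_ (X : List (Signed Atom)) : Set where
    ax   : ∀ {p} → p ⁻ ∈ X → p ⁺ ∈ X → ⊢ X
    rule : ∀ {x} → x ∈ X → (r : Rule x) → (∀ i → ⊢ added r i ++ X) → ⊢ X

  weaken : ∀ {X Y} → X ⊆ Y → ⊢ X → ⊢ Y
  weaken f (ax m n)      = ax (f m) (f n)
  weaken f (rule m r ds) = rule (f m) r (λ i → weaken (++⁺ʳ (added r i) f) (ds i))

  -- Reduction of cut to principal cuts

  Cut : Formula Atom modal → Set
  Cut p = ∀ {X} → ⊢ p ⁺ ∷ X → ⊢ p ⁻ ∷ X → ⊢ X

  -- The contexts are `X` alone: the copies of `p` that the rules retain in their premises have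
  -- already been cut away.
  PrincipalCut : Formula Atom modal → Set
  PrincipalCut p = ∀ {X} (r : Rule (p ⁺)) (s : Rule (p ⁻)) →
    (∀ i → ⊢ added r i ++ X) → (∀ j → ⊢ added s j ++ X) → ⊢ X

  -- The left derivation is followed until it acts on `p ⁺`, then the right one until it acts on
  -- `p ⁻`. Both keep their own contexts while the target `Z` grows, so no weakened derivation
  -- enters the recursion.
  cut-from-principal : ∀ {p} → PrincipalCut p → Cut p
  cut-from-principal {p} reduce d₀ e₀ = go d₀ e₀ id id
    where
    CutInto : List (Signed Atom) → Set
    CutInto X = ∀ {Y Z} → ⊢ Y → X ⊆ p ⁺ ∷ Z → Y ⊆ p ⁻ ∷ Z → ⊢ Z

    -- Here the left derivation is fixed, `cuts` is the induction hypothesis for its premises, and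
    -- the recursion is on the right derivation.
    go-principal : ∀ {X} → p ⁺ ∈ X → (r : Rule (p ⁺)) → (∀ i → ⊢ added r i ++ X) →
                   (∀ i → CutInto (added r i ++ X)) → CutInto X
    go-principal m r ds cuts (ax k n) f g with g k | g n
    -- An axiom on the cut formula puts `p ⁺` in `Z`, so the left derivation already proves the
    -- goal.
    ... | here refl | there n′ = weaken (∷-absorb n′ ∘ f) (rule m r ds)
    ... | there k′  | there n′ = ax k′ n′
    go-principal {X} m r ds cuts {Y} {Z} e@(rule k s es) f g = by-case (g k)
      where
      premise : ∀ j → ⊢ added s j ++ Z
      premise j = go-principal m r ds cuts (es j)
        (∷⁺ʳ _ (∈-++⁺ʳ (added s j)) ∘ f) (++-lift-⊆-∷ (added s j) g)

      by-case : _ ∈ p ⁻ ∷ Z → ⊢ Z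
      by-case (there k′)  = rule k′ s premise
      by-case (here refl) = reduce r s
        (λ i → cuts i e (++-lift-⊆-∷ (added r i) f) (∷⁺ʳ _ (∈-++⁺ʳ (added r i)) ∘ g)) premise

    go : ∀ {X} → ⊢ X → CutInto X
    go (ax m n) e f g with f m | f n
    ... | there m′ | here refl = weaken (∷-absorb m′ ∘ g) e
    ... | there m′ | there n′  = ax m′ n′
    go (rule m r ds) e f g with f m
    ... | there m′  = rule m′ r λ i →
          go (ds i) e (++-lift-⊆-∷ (added r i) f) (∷⁺ʳ _ (∈-++⁺ʳ (added r i)) ∘ g)
    ... | here refl = go-principal m r ds (λ i → go (ds i)) e f g

  -- Principal cuts, connective by connective

  weaken₂ : ∀ {x y X} → ⊢ x ∷ X → ⊢ x ∷ y ∷ X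
  weaken₂ = weaken (∷⁺ʳ _ there)

  -- For atoms and constants at least one side has no rule, so no principal cut exists.
  cut-atom : ∀ {a} → Cut (atom a)
  cut-atom = cut-from-principal λ ()

  cut-⊤ : Cut ⊤ᶠ
  cut-⊤ = cut-from-principal λ _ ()

  cut-⊥ : Cut ⊥ᶠ
  cut-⊥ = cut-from-principal λ ()

  cut-¬ : ∀ {p} → Cut p → Cut (¬ᶠ p)
  cut-¬ cut = cut-from-principal λ { ¬R ¬L d e → cut (e tt) (d tt) }

  cut-∧ : ∀ {p q} → Cut p → Cut q → Cut (p ∧ᶠ q)
  cut-∧ cutp cutq = cut-from-principal λ { ∧R ∧L d e →
    -- The cut on `p` is made with `q ⁻` still in the context; the outer cut removes it.
    cutq (d false) (cutp (weaken₂ (d true)) (e tt)) }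

  cut-∨ : ∀ {p q} → Cut p → Cut q → Cut (p ∨ᶠ q)
  cut-∨ cutp cutq = cut-from-principal λ { ∨R ∨L d e →
    cutq (cutp (d tt) (weaken₂ (e true))) (e false) }

  cut-→ : ∀ {p q} → Cut p → Cut q → Cut (p →ᶠ q)
  cut-→ cutp cutq = cut-from-principal λ { →R →L d e →
    cutq (cutp (weaken₂ (e true)) (d tt)) (e false) }

  -- The recursion is on the classical formula `φ`, which has no □ case; hence `cut-□` needs no
  -- hypothesis about its own formula.
  cut-embed : ∀ φ → Cut (embed φ)
  cut-embed (atom a) = cut-atom
  cut-embed ⊤ᶠ       = cut-⊤
  cut-embed ⊥ᶠ       = cut-⊥
  cut-embed (¬ᶠ φ)   = cut-¬ (cut-embed φ)
  cut-embed (φ ∧ᶠ ψ) = cut-∧ (cut-embed φ) (cut-embed ψ)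
  cut-embed (φ ∨ᶠ ψ) = cut-∨ (cut-embed φ) (cut-embed ψ)
  cut-embed (φ →ᶠ ψ) = cut-→ (cut-embed φ) (cut-embed ψ)

  cut-⋀ : ∀ {ps} → All Cut ps → Cut (⋀ ps)
  cut-⋀ []                   = cut-⊤
  cut-⋀ (cut ∷ [])           = cut
  cut-⋀ (cut ∷ cuts@(_ ∷ _)) = cut-∧ cut (cut-⋀ cuts)

  -- Matches the premise of □L, which lists the causes, with that of □R, which conjoins them.
  ⋀L : ∀ ps {X} → ⊢ map _⁻ ps ++ X → ⊢ ⋀ ps ⁻ ∷ X
  ⋀L []           d = weaken there d
  ⋀L (p ∷ [])     d = d
  ⋀L (p ∷ q ∷ ps) {X} d = rule (here refl) ∧L λ _ →
    weaken swap-⊆ (⋀L (q ∷ ps) (weaken move-⊆ d))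
    where
    move-⊆ : map _⁻ (p ∷ q ∷ ps) ++ X ⊆ map _⁻ (q ∷ ps) ++ p ⁻ ∷ X
    move-⊆ (here refl) = ∈-++⁺ʳ (map _⁻ (q ∷ ps)) (here refl)
    move-⊆ (there m)   = ++⁺ʳ (map _⁻ (q ∷ ps)) there m

    swap-⊆ : ∀ {x y z} → x ∷ y ∷ X ⊆ y ∷ x ∷ z ∷ X
    swap-⊆ (here refl)         = there (here refl)
    swap-⊆ (there (here refl)) = here refl
    swap-⊆ (there (there m))   = there (there (there m))

  cut-□ : ∀ {p} → Cut (□ p)
  cut-□ = cut-from-principal λ { (□R _ S S⊆Θ s _) (□L _) d e →
    cut-⋀ (map⁺ (universal (cut-embed ∘ cause) S)) (d tt) (⋀L (causes S) (e (S , S⊆Θ , s))) }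

  cut : ∀ p → Cut p
  cut (atom a) = cut-atom
  cut ⊤ᶠ       = cut-⊤
  cut ⊥ᶠ       = cut-⊥
  cut (¬ᶠ p)   = cut-¬ (cut p)
  cut (p ∧ᶠ q) = cut-∧ (cut p) (cut q)
  cut (p ∨ᶠ q) = cut-∨ (cut p) (cut q)
  cut (p →ᶠ q) = cut-→ (cut p) (cut q)
  cut (□ p)    = cut-□

  -- From the signed calculus back to cut-free derivations

  CutFreeDerivation : (Γ Δ : List (Formula Atom modal)) → Set
  CutFreeDerivation Γ Δ = Σ (Derivation Θ L Side Γ Δ) (NoMulticut SideCutFree)

  exchange′ : ∀ {Γ Γ′ Δ Δ′} → Γ ↭ Γ′ → Δ ↭ Δ′ → CutFreeDerivation Γ Δ → CutFreeDerivation Γ′ Δ′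
  exchange′ ρ σ (d , c) = exchange ρ σ d , c

  weaken-++ : ∀ {Γ Δ} Γ′ Δ′ → CutFreeDerivation Γ Δ → CutFreeDerivation (Γ′ ++ Γ) (Δ′ ++ Δ)
  weaken-++ []       []       d = d
  weaken-++ []       (q ∷ Δ′) d with d′ , c ← weaken-++ [] Δ′ d = weakenR d′ , c
  weaken-++ (p ∷ Γ′) Δ′       d with d′ , c ← weaken-++ Γ′ Δ′ d = weakenL d′ , c

  weaken-around : ∀ {Γ Δ} Γ′ Δ′ → CutFreeDerivation Γ Δ → CutFreeDerivation (Γ ++ Γ′) (Δ ++ Δ′)
  weaken-around Γ′ Δ′ d = exchange′ (++-comm Γ′ _) (++-comm Δ′ _) (weaken-++ Γ′ Δ′ d)

  absorbL : ∀ {Γ Δ p} → p ∈ Γ → CutFreeDerivation (p ∷ Γ) Δ → CutFreeDerivation Γ Δ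
  absorbL m (d , c) with _ , ρ ← ∈⇒↭ m =
    exchange ρ ↭-refl (contractL (exchange (prep _ (↭-sym ρ)) ↭-refl d)) , c

  absorbR : ∀ {Γ Δ p} → p ∈ Δ → CutFreeDerivation Γ (p ∷ Δ) → CutFreeDerivation Γ Δ
  absorbR m (d , c) with _ , ρ ← ∈⇒↭ m =
    exchange ↭-refl ρ (contractR (exchange ↭-refl (prep _ (↭-sym ρ)) d)) , c

  CutFreeDerivable : List (Signed Atom) → Set
  CutFreeDerivable X = CutFreeDerivation (antecedent X) (succedent X)

  absorb : ∀ {x X} → x ∈ X → CutFreeDerivable (x ∷ X) → CutFreeDerivable X
  absorb {p ⁻} m = absorbL (antecedent⁺ m)
  absorb {p ⁺} m = absorbR (succedent⁺ m)

  -- The original rule introduces a fresh copy of `x` beside the retained one; `absorb` later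
  -- contracts the two.
  rule-sound : ∀ {x X} (r : Rule x) → (∀ i → CutFreeDerivable (added r i ++ X)) → CutFreeDerivable (x ∷ X)
  rule-sound ⊥L ds = weaken-around _ _ (⊥L , tt)
  rule-sound ⊤R ds = weaken-around _ _ (⊤R , tt)
  rule-sound ¬L ds with d , c ← ds tt = ¬L d , c
  rule-sound ¬R ds with d , c ← ds tt = ¬R d , c
  rule-sound ∧L ds with d , c ← ds tt = ∧L d , c
  rule-sound ∧R ds with d , c ← ds true | e , c′ ← ds false = ∧R d e , c , c′
  rule-sound ∨L ds with d , c ← ds true | e , c′ ← ds false = ∨L d e , c , c′
  rule-sound ∨R ds with d , c ← ds tt = ∨R d , c
  rule-sound →L ds with d , c ← ds true | e , c′ ← ds false = →L d e , c , c′
  rule-sound →R ds with d , c ← ds tt = →R d , c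
  rule-sound {X = X} (□L {p} l) ds =
    □L l (λ S S⊆Θ s → proj₁ (premise S S⊆Θ s)) , λ S S⊆Θ s → proj₂ (premise S S⊆Θ s)
    where
    premise : ∀ S → All Θ S → Side S p → CutFreeDerivation (causes S ++ antecedent X) (succedent X)
    premise S S⊆Θ s =
      subst₂ CutFreeDerivation (antecedent-map⁻ (causes S) X) (succedent-map⁻ (causes S) X)
        (ds (S , S⊆Θ , s))
  rule-sound (□R l S S⊆Θ s cf) ds with d , c ← ds tt = □R l S S⊆Θ s d , cf , c

  sound : ∀ {X} → ⊢ X → CutFreeDerivable X
  sound (ax m n) =
    absorbL (antecedent⁺ m) (absorbR (succedent⁺ n) (weaken-around _ _ (axiom , tt)))
  sound (rule m r ds) = absorb m (rule-sound r (λ i → sound (ds i)))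

  -- From derivations with multicut to the signed calculus

  infix 4 _⊑⁻_ _⊑⁺_

  _⊑⁻_ _⊑⁺_ : List (Formula Atom modal) → List (Signed Atom) → Set
  Γ ⊑⁻ X = ∀ {p} → p ∈ Γ → p ⁻ ∈ X
  Δ ⊑⁺ X = ∀ {p} → p ∈ Δ → p ⁺ ∈ X

  ∷-⊑⁻ : ∀ {p Γ X} → p ⁻ ∈ X → Γ ⊑⁻ X → p ∷ Γ ⊑⁻ X
  ∷-⊑⁻ i f (here refl) = i
  ∷-⊑⁻ i f (there m)   = f m

  ∷-⊑⁺ : ∀ {p Δ X} → p ⁺ ∈ X → Δ ⊑⁺ X → p ∷ Δ ⊑⁺ X
  ∷-⊑⁺ i f (here refl) = i
  ∷-⊑⁺ i f (there m)   = f m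

  ++-⊑⁻ : ∀ Γ {Γ′ X} → Γ′ ⊑⁻ X → Γ ++ Γ′ ⊑⁻ map _⁻ Γ ++ X
  ++-⊑⁻ Γ f m with ∈-++⁻ Γ m
  ... | inj₁ i = ∈-++⁺ˡ (∈-map⁺ _⁻ i)
  ... | inj₂ i = ∈-++⁺ʳ (map _⁻ Γ) (f i)

  module _ (normalise : ∀ {S p} → Side S p → Σ[ s ∈ Side S p ] SideCutFree s) where

    -- With `X` arbitrary, a structural rule only changes the two containments.
    complete : ∀ {Γ Δ X} → Derivation Θ L Side Γ Δ → Γ ⊑⁻ X → Δ ⊑⁺ X → ⊢ X
    complete (exchange ρ σ d) f g = complete d (f ∘ ∈-resp-↭ ρ) (g ∘ ∈-resp-↭ σ)
    complete axiom f g = ax (f (here refl)) (g (here refl))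
    complete ⊥L f g = rule (f (here refl)) ⊥L λ ()
    complete ⊤R f g = rule (g (here refl)) ⊤R λ ()
    complete (weakenL d) f g = complete d (f ∘ there) g
    complete (weakenR d) f g = complete d f (g ∘ there)
    complete (contractL d) f g = complete d (∷-⊑⁻ (f (here refl)) f) g
    complete (contractR d) f g = complete d f (∷-⊑⁺ (g (here refl)) g)
    complete (¬L d) f g = rule (f (here refl)) ¬L λ _ →
      complete d (there ∘ f ∘ there) (∷-⊑⁺ (here refl) (there ∘ g))
    complete (¬R d) f g = rule (g (here refl)) ¬R λ _ →
      complete d (∷-⊑⁻ (here refl) (there ∘ f)) (there ∘ g ∘ there)
    complete (∧L d) f g = rule (f (here refl)) ∧L λ _ →
      complete d (∷-⊑⁻ (here refl) (∷-⊑⁻ (there (here refl)) (there ∘ there ∘ f ∘ there)))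
        (there ∘ there ∘ g)
    complete (∧R d e) f g = rule (g (here refl)) ∧R λ
      { true  → complete d (there ∘ f) (∷-⊑⁺ (here refl) (there ∘ g ∘ there))
      ; false → complete e (there ∘ f) (∷-⊑⁺ (here refl) (there ∘ g ∘ there)) }
    complete (∨L d e) f g = rule (f (here refl)) ∨L λ
      { true  → complete d (∷-⊑⁻ (here refl) (there ∘ f ∘ there)) (there ∘ g)
      ; false → complete e (∷-⊑⁻ (here refl) (there ∘ f ∘ there)) (there ∘ g) }
    complete (∨R d) f g = rule (g (here refl)) ∨R λ _ →
      complete d (there ∘ there ∘ f)
        (∷-⊑⁺ (here refl) (∷-⊑⁺ (there (here refl)) (there ∘ there ∘ g ∘ there)))
    complete (→L d e) f g = rule (f (here refl)) →L λ
      { true  → complete d (there ∘ f ∘ there) (∷-⊑⁺ (here refl) (there ∘ g))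
      ; false → complete e (∷-⊑⁻ (here refl) (there ∘ f ∘ there)) (there ∘ g) }
    complete (→R d) f g = rule (g (here refl)) →R λ _ →
      complete d (∷-⊑⁻ (here refl) (there ∘ there ∘ f))
        (∷-⊑⁺ (there (here refl)) (there ∘ there ∘ g ∘ there))
    -- The witness `s` may use multicut; `s′` replaces it for the same `S` and formula.
    complete (□R l S S⊆Θ s d) f g with s′ , cf ← normalise s =
      rule (g (here refl)) (□R l S S⊆Θ s′ cf) λ _ →
        complete d (there ∘ f) (∷-⊑⁺ (here refl) (there ∘ g ∘ there))
    complete (□L l ds) f g = rule (f (here refl)) (□L l) λ (S , S⊆Θ , s) →
      complete (ds S S⊆Θ s) (++-⊑⁻ (causes S) (f ∘ there)) (∈-++⁺ʳ (map _⁻ (causes S)) ∘ g)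
    -- Containment ignores multiplicity, so all copies of `p` collapse to one and a single cut
    -- suffices.
    complete (multicut {Γ} {Γ′} {Δ} {Δ′} {p} _ m n d e) f g = cut p
      (complete d (there ∘ f ∘ ∈-++⁺ˡ)
        (∷-⊑⁺ (here refl) (there ∘ g ∘ ∈-++⁺ˡ) ∘ replicate-++⁻ (suc m)))
      (complete e (∷-⊑⁻ (here refl) (there ∘ f ∘ ∈-++⁺ʳ Γ) ∘ replicate-++⁻ (suc n))
        (there ∘ g ∘ ∈-++⁺ʳ Δ))

    eliminate-multicut : ∀ {Γ Δ} → Derivation Θ L Side Γ Δ → CutFreeDerivation Γ Δ
    eliminate-multicut {Γ} {Δ} d =
      subst₂ CutFreeDerivation
        (trans (antecedent-map⁻ Γ _) (trans (cong (Γ ++_) (antecedent-map⁺ Δ)) (++-identityʳ Γ)))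
        (trans (succedent-map⁻ Γ _) (succedent-map⁺ Δ))
        (sound (complete d (∈-++⁺ˡ ∘ ∈-map⁺ _⁻) (∈-++⁺ʳ (map _⁻ Γ) ∘ ∈-map⁺ _⁺)))

-- Side conditions, by recursion on modal depth

eliminate-multicut-bounded : ∀ {Atom} {Θ : CausalTheory Atom} n (a : Acc _<_ n) {Γ Δ} →
  Bounded Θ n a Γ Δ → Σ[ d ∈ Bounded Θ n a Γ Δ ] BoundedCutFree n a d
eliminate-multicut-bounded n (acc rs) =
  -- A side condition is a derivation at the smaller bound `depth p`, so the recursive call at
  -- `rs lt` supplies `normalise`.
  eliminate-multicut _ λ {_} {p} (lt , d) →
    let d′ , c = eliminate-multicut-bounded (depth p) (rs lt) d in (lt , d′) , c

mainTheorem7 : (Atom : Set) (Θ : CausalTheory Atom) (Γ Δ : List (Formula Atom modal)) →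
    S[ Θ ] Γ Δ → Σ[ d ∈ S[ Θ ] Γ Δ ] CutFree d
mainTheorem7 Atom Θ Γ Δ =
  eliminate-multicut _ λ {_} {p} → eliminate-multicut-bounded (depth p) (<-wellFounded (depth p))
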